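{- Let $\nu$ be a lattice path and let $\mathtt{sch}_\nu(i)$ denote the number of $\nu$-Schröder paths with exactly $i$ diagonal steps. Then $$\sum_{i\geq 0} (-1)^i\,\mathtt{sch}_\nu(i) = 1.$$
   Context: A lattice path from $(0,0)$ to $(b,a)\in\mathbb{Z}_{\ge 0}^2$ is a sequence of $a$ north steps $N=(0,1)$ and $b$ east steps $E=(1,0)$. For such a path $\nu$, a $\nu$-Schröder path is a path from $(0,0)$ to $(b,a)$ with steps $N=(0,1)$, $E=(1,0)$, $D=(1,1)$ (diagonal) which stays weakly above $\nu$. -}

module Defs where

open import Data.Integer.Base as ℤ using (ℤ; 0ℤ)
open import Data.List.Base using (List; []; _∷_; map; foldr; length; filter; applyUpTo; upTo; concatMap; cartesianProductWith)
open import Data.List.Relation.Unary.All using (All; all?)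
open import Data.List.Relation.Unary.Any using (Any; any?)
open import Data.Nat.Base using (ℕ; zero; suc; _+_; _≤_)
open import Data.Nat.Properties using (_≟_; _≤?_)
open import Data.Product.Base using (_×_; _,_; proj₁; proj₂; ∃-syntax)
open import Data.Product.Properties using (≡-dec)
open import Relation.Binary.PropositionalEquality.Core using (_≡_; refl)
open import Relation.Nullary.Decidable.Core using (Dec; yes; no; _×-dec_)

data LatticeStep : Set where
  N E : LatticeStep

data Step : Set where
  N E D : Step

LatticePath : Set
LatticePath = List LatticeStep

Path : Set
Path = List Step

toStep : LatticeStep → Step
toStep N = N
toStep E = E

toPath : LatticePath → Path
toPath = map toStep

Point : Set
Point = ℕ × ℕ

infixl 6 _⊕_

_⊕_ : Point → Point → Point
(x , y) ⊕ (x′ , y′) = x + x′ , y + y′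

origin : Point
origin = 0 , 0

displacement : Step → Point
displacement N = 0 , 1
displacement E = 1 , 0
displacement D = 1 , 1

endpoint : Path → Point
endpoint = foldr (λ s p → displacement s ⊕ p) origin

-- The lattice points visited by a path together with the midpoints of its
-- steps, in coordinates scaled by 2 so that the midpoints are integral.
trace : Point → Path → List Point
trace p []      = p ∷ []
trace p (s ∷ w) = p ∷ p ⊕ displacement s ∷ trace (p ⊕ displacement s ⊕ displacement s) w

-- Every point of μ has a point of ν at or vertically below it.  The midpoints
-- cannot be omitted: for ν = NE, the step D has both its endpoints on ν but
-- runs below ν in between.  They suffice, because inside a unit column ν is
-- horizontal at some integer height h, and a step E or D of μ starting at
-- integer height k lies weakly above ν there exactly when h ≤ k, which for D is
-- the same as h ≤ k + 1/2.
_WeaklyAbove_ : Path → Path → Set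
μ WeaklyAbove ν =
  All (λ p → Any (λ q → proj₁ q ≡ proj₁ p × proj₂ q ≤ proj₂ p) (trace origin ν))
      (trace origin μ)

_weaklyAbove?_ : ∀ μ ν → Dec (μ WeaklyAbove ν)
μ weaklyAbove? ν =
  all? (λ p → any? (λ q → (proj₁ q ≟ proj₁ p) ×-dec (proj₂ q ≤? proj₂ p)) (trace origin ν))
       (trace origin μ)

IsSchröderPath : LatticePath → Path → Set
IsSchröderPath ν μ = endpoint μ ≡ endpoint (toPath ν) × μ WeaklyAbove toPath ν

isSchröderPath? : ∀ ν μ → Dec (IsSchröderPath ν μ)
isSchröderPath? ν μ = ≡-dec _≟_ _≟_ (endpoint μ) (endpoint (toPath ν)) ×-dec (μ weaklyAbove? toPath ν)

isDiagonal? : ∀ s → Dec (s ≡ D)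
isDiagonal? N = no λ ()
isDiagonal? E = no λ ()
isDiagonal? D = yes refl

diagonals : Path → ℕ
diagonals μ = length (filter isDiagonal? μ)

pathsOfLength : ℕ → List Path
pathsOfLength zero    = [] ∷ []
pathsOfLength (suc n) = cartesianProductWith _∷_ (N ∷ E ∷ D ∷ []) (pathsOfLength n)

pathsUpToLength : ℕ → List Path
pathsUpToLength n = concatMap pathsOfLength (upTo (suc n))

-- A path to (b , a) has at most a + b steps, and a + b is the length of ν, so
-- the enumeration contains every ν-Schröder path, exactly once.
sch : LatticePath → ℕ → ℕ
sch ν i =
  length (filter (λ μ → isSchröderPath? ν μ ×-dec (diagonals μ ≟ i)) (pathsUpToLength (length ν)))

-- The sum over all i ≥ 0 of a finitely supported sequence.
_SumsTo_ : (ℕ → ℤ) → ℤ → Set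
f SumsTo s =
  ∃[ n ] (∀ i → n ≤ i → f i ≡ 0ℤ) × foldr ℤ._+_ 0ℤ (applyUpTo f n) ≡ s

{-# OPTIONS --safe #-}
-- For a lattice point p weakly above ν, let f(p) be the sum of (-1)^(number of
-- diagonal steps) over the ways to complete a path from p.  A diagonal step is
-- available exactly when both a north and an east step are.  So if p is not the
-- endpoint then, by induction, f(p) is 1 + 1 - 1 when all three steps are
-- available and 1 when only one of them is; hence f(origin) = 1.
module Submission where

open import Defs
open import Data.Integer.Base using (+_; -1ℤ; 1ℤ; _*_; _^_)
open import Data.Bool.Base using (if_then_else_)
open import Data.Integer.Base using (ℤ; 0ℤ) renaming (_+_ to _+ℤ_)
import Data.Integer.Properties as ℤ
open import Data.List.Base using (List; []; _∷_; _++_; map; foldr; length; filter; applyUpTo; upTo; concatMap)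
open import Data.List.Extrema.Nat using (max; xs≤max)
open import Data.List.Membership.Propositional using (_∈_; find; lose)
open import Data.List.Properties using (map-upTo; filter-none)
open import Data.List.Relation.Unary.All as All using (All; []; _∷_; all?)
open import Data.List.Relation.Unary.All.Properties using (map⁻)
open import Data.List.Relation.Unary.Any as Any using (Any; here; there; any?)
import Data.Nat.Base as ℕ
open import Data.Nat.Base using (ℕ; zero; suc; _≤_; _<_; z≤n; s≤s)
import Data.Nat.Properties as ℕ
open import Data.Nat.Tactic.RingSolver using (solve-∀)
open import Data.Product.Base using (_×_; _,_; proj₁; proj₂; ∃-syntax; map₂)
open import Data.Product.Properties using (≡-dec)
open import Function.Base using (_∘_)
open import Function.Bundles using (_⇔_; mk⇔)
open import Relation.Binary.PropositionalEquality
open import Relation.Nullary.Decidable using (Dec; yes; no; does; dec-true; dec-false; does-⇔; _×-dec_)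
open import Relation.Nullary.Negation using (¬_; contradiction)
open import Relation.Unary using (Decidable)
open import Algebra.Properties.CommutativeSemigroup ℤ.+-commutativeSemigroup using (interchange)

-- Integers guarded by a decidable condition.

infix 7 _when_

_when_ : {P : Set} → ℤ → Dec P → ℤ
z when P? = if does P? then z else 0ℤ

when-true : {P : Set} {z : ℤ} (P? : Dec P) → P → z when P? ≡ z
when-true P? p rewrite dec-true P? p = refl

when-false : {P : Set} {z : ℤ} (P? : Dec P) → ¬ P → z when P? ≡ 0ℤ
when-false P? ¬p rewrite dec-false P? ¬p = refl

when-⇔ : {P Q : Set} {z : ℤ} → P ⇔ Q → (P? : Dec P) (Q? : Dec Q) → z when P? ≡ z when Q?
when-⇔ {z = z} P⇔Q P? Q? = cong (if_then z else 0ℤ) (does-⇔ P⇔Q P? Q?)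

*-when : {P : Set} (w z : ℤ) (P? : Dec P) → (w * z) when P? ≡ w * (z when P?)
*-when w z (yes _) = refl
*-when w z (no _)  = sym (ℤ.*-zeroʳ w)

-- Finite sums of integers.

∑ : {A : Set} → (A → ℤ) → List A → ℤ
∑ f xs = foldr _+ℤ_ 0ℤ (map f xs)

module _ {A : Set} where

  ∑-cong-local : {f g : A → ℤ} {xs : List A} → All (λ x → f x ≡ g x) xs → ∑ f xs ≡ ∑ g xs
  ∑-cong-local []         = refl
  ∑-cong-local (eq ∷ eqs) = cong₂ _+ℤ_ eq (∑-cong-local eqs)

  ∑-cong : {f g : A → ℤ} → (∀ x → f x ≡ g x) → (xs : List A) → ∑ f xs ≡ ∑ g xs
  ∑-cong f≗g xs = ∑-cong-local (All.universal f≗g xs)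

  ∑-zero : {f : A → ℤ} → (∀ x → f x ≡ 0ℤ) → (xs : List A) → ∑ f xs ≡ 0ℤ
  ∑-zero f≗0 []       = refl
  ∑-zero f≗0 (x ∷ xs) = cong₂ _+ℤ_ (f≗0 x) (∑-zero f≗0 xs)

  ∑-+ : (f g : A → ℤ) (xs : List A) → ∑ (λ x → f x +ℤ g x) xs ≡ ∑ f xs +ℤ ∑ g xs
  ∑-+ f g []       = refl
  ∑-+ f g (x ∷ xs) = trans (cong ((f x +ℤ g x) +ℤ_) (∑-+ f g xs))
                           (interchange (f x) (g x) (∑ f xs) (∑ g xs))

  ∑-* : (z : ℤ) (f : A → ℤ) (xs : List A) → ∑ (λ x → z * f x) xs ≡ z * ∑ f xs
  ∑-* z f []       = sym (ℤ.*-zeroʳ z)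
  ∑-* z f (x ∷ xs) = trans (cong (z * f x +ℤ_) (∑-* z f xs))
                           (sym (ℤ.*-distribˡ-+ z (f x) (∑ f xs)))

  ∑-++ : (f : A → ℤ) (xs ys : List A) → ∑ f (xs ++ ys) ≡ ∑ f xs +ℤ ∑ f ys
  ∑-++ f []       ys = sym (ℤ.+-identityˡ (∑ f ys))
  ∑-++ f (x ∷ xs) ys = trans (cong (f x +ℤ_) (∑-++ f xs ys))
                             (sym (ℤ.+-assoc (f x) (∑ f xs) (∑ f ys)))

  *-length-filter : {P : A → Set} (z : ℤ) (P? : Decidable P) (xs : List A) →
                    z * + length (filter P? xs) ≡ ∑ (λ x → z when P? x) xs
  *-length-filter z P? []       = ℤ.*-zeroʳ z
  *-length-filter z P? (x ∷ xs) with P? x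
  ... | yes _ = trans (ℤ.*-suc z _) (cong (z +ℤ_) (*-length-filter z P? xs))
  ... | no _  = trans (*-length-filter z P? xs) (sym (ℤ.+-identityˡ _))

module _ {A B : Set} where

  ∑-map : (f : B → ℤ) (g : A → B) (xs : List A) → ∑ f (map g xs) ≡ ∑ (f ∘ g) xs
  ∑-map f g []       = refl
  ∑-map f g (x ∷ xs) = cong (f (g x) +ℤ_) (∑-map f g xs)

  ∑-concatMap : (f : B → ℤ) (g : A → List B) (xs : List A) →
                ∑ f (concatMap g xs) ≡ ∑ (λ x → ∑ f (g x)) xs
  ∑-concatMap f g []       = refl
  ∑-concatMap f g (x ∷ xs) = trans (∑-++ f (g x) (concatMap g xs))
                                   (cong (∑ f (g x) +ℤ_) (∑-concatMap f g xs))

  ∑-swap : (f : A → B → ℤ) (xs : List A) (ys : List B) →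
           ∑ (λ x → ∑ (f x) ys) xs ≡ ∑ (λ y → ∑ (λ x → f x y) xs) ys
  ∑-swap f []       ys = sym (∑-zero (λ _ → refl) ys)
  ∑-swap f (x ∷ xs) ys = trans (cong (∑ (f x) ys +ℤ_) (∑-swap f xs ys))
                               (sym (∑-+ (f x) (λ y → ∑ (λ x′ → f x′ y) xs) ys))

-- Sums over initial segments and alternating counts.

∑-upTo-suc : (f : ℕ → ℤ) (n : ℕ) → ∑ f (upTo (suc n)) ≡ f 0 +ℤ ∑ (f ∘ suc) (upTo n)
∑-upTo-suc f n = cong (f 0 +ℤ_)
  -- The tail of `upTo (suc n)` unfolds to `applyUpTo suc n`, which must become a `map` before
  -- `∑-map` applies.
  (trans (cong (∑ f) (sym (map-upTo suc n))) (∑-map f suc (upTo n)))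

∑-upTo-single : {f : ℕ → ℤ} {d n : ℕ} → (∀ i → i ≢ d → f i ≡ 0ℤ) → d < n → ∑ f (upTo n) ≡ f d
∑-upTo-single {f} {zero}  {suc n} f≗0 _         = begin
  ∑ f (upTo (suc n))             ≡⟨ ∑-upTo-suc f n ⟩
  f 0 +ℤ ∑ (f ∘ suc) (upTo n)   ≡⟨ cong (f 0 +ℤ_) (∑-zero (λ i → f≗0 (suc i) λ ()) (upTo n)) ⟩
  f 0 +ℤ 0ℤ                     ≡⟨ ℤ.+-identityʳ (f 0) ⟩
  f 0                            ∎
  where open ≡-Reasoning
∑-upTo-single {f} {suc d} {suc n} f≗0 (s≤s d<n) = begin
  ∑ f (upTo (suc n))             ≡⟨ ∑-upTo-suc f n ⟩
  f 0 +ℤ ∑ (f ∘ suc) (upTo n)   ≡⟨ cong₂ _+ℤ_ (f≗0 0 λ ())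
                                      (∑-upTo-single (λ i i≢d → f≗0 (suc i) (i≢d ∘ ℕ.suc-injective)) d<n) ⟩
  0ℤ +ℤ f (suc d)               ≡⟨ ℤ.+-identityˡ (f (suc d)) ⟩
  f (suc d)                      ∎
  where open ≡-Reasoning

-- Exchanging the two sums turns the counts per value of `d` into one sum over `xs`: an entry is
-- counted only at `i = d x`, with sign `-1ℤ ^ d x`.
count-SumsTo : {A : Set} {P : A → Set} (P? : Decidable P) (d : A → ℕ) (xs : List A) →
  (λ i → (-1ℤ ^ i) * (+ length (filter (λ x → P? x ×-dec (d x ℕ.≟ i)) xs)))
    SumsTo ∑ (λ x → (-1ℤ ^ d x) when P? x) xs
count-SumsTo P? d xs = n , vanish , (begin
  foldr _+ℤ_ 0ℤ (applyUpTo count n)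
    ≡⟨ cong (foldr _+ℤ_ 0ℤ) (map-upTo count n) ⟨
  ∑ count (upTo n)
    ≡⟨ ∑-cong (λ i → *-length-filter (-1ℤ ^ i) (Q? i) xs) (upTo n) ⟩
  ∑ (λ i → ∑ (λ x → (-1ℤ ^ i) when Q? i x) xs) (upTo n)
    ≡⟨ ∑-swap (λ i x → (-1ℤ ^ i) when Q? i x) (upTo n) xs ⟩
  ∑ (λ x → ∑ (λ i → (-1ℤ ^ i) when Q? i x) (upTo n)) xs
    ≡⟨ ∑-cong-local (All.map (λ {x} → single x) d<n) ⟩
  ∑ (λ x → (-1ℤ ^ d x) when P? x) xs ∎)
  where
  open ≡-Reasoning
  -- One more than the largest value of `d` on `xs`, so that every value occurs below `n` and all
  -- later counts vanish; the default 0 covers empty `xs`.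
  n = suc (max 0 (map d xs))
  Q? = λ i x → P? x ×-dec (d x ℕ.≟ i)
  count = λ i → (-1ℤ ^ i) * (+ length (filter (Q? i) xs))

  d<n : All (λ x → d x < n) xs
  d<n = All.map s≤s (map⁻ (xs≤max 0 (map d xs)))

  vanish : ∀ i → n ≤ i → count i ≡ 0ℤ
  vanish i n≤i = trans
    (cong (λ ys → (-1ℤ ^ i) * (+ length ys))
      (filter-none (Q? i) (All.map (λ dx<n (_ , dx≡i) → ℕ.<⇒≢ (ℕ.<-≤-trans dx<n n≤i) dx≡i) d<n)))
    (ℤ.*-zeroʳ (-1ℤ ^ i))

  single : ∀ x → d x < n → ∑ (λ i → (-1ℤ ^ i) when Q? i x) (upTo n) ≡ (-1ℤ ^ d x) when P? x
  single x dx<n = trans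
    (∑-upTo-single (λ i i≢dx → when-false (Q? i x) (λ (_ , dx≡i) → i≢dx (sym dx≡i))) dx<n)
    (when-⇔ (mk⇔ proj₁ (_, refl)) (Q? (d x) x) (P? x))

-- Sums over enumerated paths, split at the first step.

∑-pathsOfLength : (f : Path → ℤ) (n : ℕ) →
  ∑ f (pathsOfLength (suc n)) ≡
  ∑ (f ∘ (N ∷_)) (pathsOfLength n) +ℤ
    (∑ (f ∘ (E ∷_)) (pathsOfLength n) +ℤ ∑ (f ∘ (D ∷_)) (pathsOfLength n))
∑-pathsOfLength f n = begin
  -- The trailing `[]` is what `cartesianProductWith` leaves after the last of the three steps.
  ∑ f (map (N ∷_) ws ++ map (E ∷_) ws ++ map (D ∷_) ws ++ [])
    ≡⟨ ∑-++ f (map (N ∷_) ws) _ ⟩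
  ∑ f (map (N ∷_) ws) +ℤ ∑ f (map (E ∷_) ws ++ map (D ∷_) ws ++ [])
    ≡⟨ cong₂ _+ℤ_ (∑-map f (N ∷_) ws) (∑-++ f (map (E ∷_) ws) _) ⟩
  ∑ (f ∘ (N ∷_)) ws +ℤ (∑ f (map (E ∷_) ws) +ℤ ∑ f (map (D ∷_) ws ++ []))
    ≡⟨ cong (∑ (f ∘ (N ∷_)) ws +ℤ_) (cong₂ _+ℤ_ (∑-map f (E ∷_) ws)
         (trans (∑-++ f (map (D ∷_) ws) []) (trans (ℤ.+-identityʳ _) (∑-map f (D ∷_) ws)))) ⟩
  ∑ (f ∘ (N ∷_)) ws +ℤ (∑ (f ∘ (E ∷_)) ws +ℤ ∑ (f ∘ (D ∷_)) ws) ∎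
  where
  open ≡-Reasoning
  ws = pathsOfLength n

-- A nonempty path is a first step followed by a path one shorter, so the length bound drops by one;
-- `∑-weight` recurses along this.
∑-pathsUpToLength : (f : Path → ℤ) (n : ℕ) →
  ∑ f (pathsUpToLength (suc n)) ≡
  f [] +ℤ (∑ (f ∘ (N ∷_)) (pathsUpToLength n) +ℤ
    (∑ (f ∘ (E ∷_)) (pathsUpToLength n) +ℤ ∑ (f ∘ (D ∷_)) (pathsUpToLength n)))
∑-pathsUpToLength f n = begin
  ∑ f (pathsUpToLength (suc n))
    ≡⟨ ∑-concatMap f pathsOfLength (upTo (suc (suc n))) ⟩
  ∑ (λ k → ∑ f (pathsOfLength k)) (upTo (suc (suc n)))
    ≡⟨ ∑-upTo-suc (λ k → ∑ f (pathsOfLength k)) (suc n) ⟩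
  f [] +ℤ 0ℤ +ℤ ∑ (λ k → ∑ f (pathsOfLength (suc k))) ks
    ≡⟨ cong₂ _+ℤ_ (ℤ.+-identityʳ (f [])) (∑-cong (∑-pathsOfLength f) ks) ⟩
  f [] +ℤ ∑ (λ k → by N k +ℤ (by E k +ℤ by D k)) ks
    ≡⟨ cong (f [] +ℤ_) (trans (∑-+ (by N) _ ks) (cong (∑ (by N) ks +ℤ_) (∑-+ (by E) (by D) ks))) ⟩
  f [] +ℤ (∑ (by N) ks +ℤ (∑ (by E) ks +ℤ ∑ (by D) ks))
    ≡⟨ cong (f [] +ℤ_) (cong₂ _+ℤ_ (regroup N) (cong₂ _+ℤ_ (regroup E) (regroup D))) ⟩
  f [] +ℤ (∑ (f ∘ (N ∷_)) (pathsUpToLength n) +ℤ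
    (∑ (f ∘ (E ∷_)) (pathsUpToLength n) +ℤ ∑ (f ∘ (D ∷_)) (pathsUpToLength n))) ∎
  where
  open ≡-Reasoning
  ks = upTo (suc n)

  by : Step → ℕ → ℤ
  by s k = ∑ (f ∘ (s ∷_)) (pathsOfLength k)

  regroup : ∀ s → ∑ (by s) ks ≡ ∑ (f ∘ (s ∷_)) (pathsUpToLength n)
  regroup s = sym (∑-concatMap (f ∘ (s ∷_)) pathsOfLength ks)

-- Points and traces in doubled coordinates.

⊕-assoc : (p q r : Point) → p ⊕ q ⊕ r ≡ p ⊕ (q ⊕ r)
⊕-assoc (x , y) (x′ , y′) (x″ , y″) = cong₂ _,_ (ℕ.+-assoc x x′ x″) (ℕ.+-assoc y y′ y″)

⊕-cancelˡ : (p : Point) {q r : Point} → p ⊕ q ≡ p ⊕ r → q ≡ r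
⊕-cancelˡ (x , y) eq = cong₂ _,_ (ℕ.+-cancelˡ-≡ x _ _ (cong proj₁ eq)) (ℕ.+-cancelˡ-≡ y _ _ (cong proj₂ eq))

double : Point → Point
double (x , y) = x ℕ.* 2 , y ℕ.* 2

double-⊕ : (p q : Point) → double (p ⊕ q) ≡ double p ⊕ q ⊕ q
double-⊕ (x , y) (x′ , y′) = cong₂ _,_ (lemma x x′) (lemma y y′)
  where
  lemma : ∀ m n → (m ℕ.+ n) ℕ.* 2 ≡ m ℕ.* 2 ℕ.+ n ℕ.+ n
  lemma = solve-∀

double≢odd : (m n : ℕ) → m ℕ.* 2 ≢ suc (n ℕ.* 2)
double≢odd m n rewrite ℕ.*-comm m 2 | ℕ.*-comm n 2 = ℕ.even≢odd m n

head∈trace : (p : Point) (w : Path) → p ∈ trace p w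
head∈trace p []      = here refl
head∈trace p (_ ∷ _) = here refl

-- Brings the start of the remaining trace back to the form `double q`, so that inductions along a
-- path range over lattice points.
trace-double-∷ : (p : Point) (s : Step) (w : Path) →
  trace (double p) (s ∷ w) ≡
  double p ∷ double p ⊕ displacement s ∷ trace (double (p ⊕ displacement s)) w
trace-double-∷ p s w =
  cong (λ q → double p ∷ double p ⊕ displacement s ∷ trace q w) (sym (double-⊕ p (displacement s)))

-- A lattice path meets an odd column only in the midpoint of an east step.
odd∈trace : (p : Point) (ν : LatticePath) (x : ℕ) {k : ℕ} →
  (suc (x ℕ.* 2) , k) ∈ trace (double p) (toPath ν) →
  (∃[ h ] k ≡ h ℕ.* 2) × (suc (suc (x ℕ.* 2)) , k) ∈ trace (double p) (toPath ν)
odd∈trace p []      x (here eq) = contradiction (sym (cong proj₁ eq)) (double≢odd (proj₁ p) x)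
odd∈trace p (s ∷ ν) x {k} q∈ rewrite trace-double-∷ p (toStep s) (toPath ν) = go s q∈
  where
  tail : LatticeStep → List Point
  tail s = trace (double (p ⊕ displacement (toStep s))) (toPath ν)

  go : ∀ s → (suc (x ℕ.* 2) , k) ∈ double p ∷ double p ⊕ displacement (toStep s) ∷ tail s →
       (∃[ h ] k ≡ h ℕ.* 2) ×
       (suc (suc (x ℕ.* 2)) , k) ∈ double p ∷ double p ⊕ displacement (toStep s) ∷ tail s
  go s (here eq)         = contradiction (sym (cong proj₁ eq)) (double≢odd (proj₁ p) x)
  go s (there (there q∈)) = map₂ (there ∘ there) (odd∈trace (p ⊕ displacement (toStep s)) ν x q∈)
  go N (there (here eq)) = contradiction (sym (trans (cong proj₁ eq) (ℕ.+-identityʳ _))) (double≢odd (proj₁ p) x)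
  -- The midpoint has the even height of the start of the step; the end of the step, one column
  -- further at the same height, heads the remaining trace.
  go E (there (here eq)) =
    (proj₂ p , trans (cong proj₂ eq) (ℕ.+-identityʳ _)) ,
    there (there (subst (_∈ tail E) next (head∈trace _ (toPath ν))))
    where
    next : double (p ⊕ (1 , 0)) ≡ (suc (suc (x ℕ.* 2)) , k)
    next = trans (double-⊕ p (1 , 0)) (cong₂ _,_
      (trans (cong (ℕ._+ 1) (sym (cong proj₁ eq))) (ℕ.+-comm _ 1))
      (trans (cong (ℕ._+ 0) (sym (cong proj₂ eq))) (ℕ.+-identityʳ _)))

-- Makes the length bound in `sch` the number of unit steps to the endpoint, as `∑-weight` requires.
endpoint-length : (ν : LatticePath) →
  proj₁ (endpoint (toPath ν)) ℕ.+ proj₂ (endpoint (toPath ν)) ≡ length ν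
endpoint-length []      = refl
endpoint-length (N ∷ ν) = trans (ℕ.+-suc _ _) (cong suc (endpoint-length ν))
endpoint-length (E ∷ ν) = cong suc (endpoint-length ν)

OnOrAbove : Point → Point → Set
OnOrAbove p q = proj₁ q ≡ proj₁ p × proj₂ q ≤ proj₂ p

-- The path must still cross from column `x` to `x + 1`. It does so by an east step, which cannot be
-- higher than the final height `a` because heights never decrease.
top-above-odd : (p : Point) (ν : LatticePath) {x b a : ℕ} → p ⊕ endpoint (toPath ν) ≡ (b , a) →
  proj₁ p ≤ x → x < b → Any (OnOrAbove (suc (x ℕ.* 2) , a ℕ.* 2)) (trace (double p) (toPath ν))
top-above-odd p []      refl p≤x x<b =
  contradiction (ℕ.<-≤-trans x<b (ℕ.≤-trans (ℕ.≤-reflexive (ℕ.+-identityʳ _)) p≤x)) (ℕ.<-irrefl refl)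
top-above-odd p (s ∷ ν) {x} {b} {a} end p≤x x<b
  rewrite trace-double-∷ p (toStep s) (toPath ν) = go s (trans (⊕-assoc p _ _) end)
  where
  go : ∀ s → p ⊕ displacement (toStep s) ⊕ endpoint (toPath ν) ≡ (b , a) →
       Any (OnOrAbove (suc (x ℕ.* 2) , a ℕ.* 2))
           (double p ∷ double p ⊕ displacement (toStep s) ∷
            trace (double (p ⊕ displacement (toStep s))) (toPath ν))
  go N end = there (there (top-above-odd (p ⊕ (0 , 1)) ν end
    (ℕ.≤-trans (ℕ.≤-reflexive (ℕ.+-identityʳ _)) p≤x) x<b))
  go E end with proj₁ p ℕ.≟ x
  ... | yes refl = there (here (ℕ.+-comm _ 1 , ℕ.≤-trans (ℕ.≤-reflexive (ℕ.+-identityʳ _)) (ℕ.*-monoˡ-≤ 2 p≤a)))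
    where
    p≤a : proj₂ p ≤ a
    p≤a = ℕ.≤-trans (ℕ.m≤m+n _ 0) (ℕ.≤-trans (ℕ.m≤m+n _ _) (ℕ.≤-reflexive (cong proj₂ end)))
  ... | no p≢x   = there (there (top-above-odd (p ⊕ (1 , 0)) ν end
          (ℕ.≤-trans (ℕ.≤-reflexive (ℕ.+-comm _ 1)) (ℕ.≤∧≢⇒< p≤x p≢x)) x<b))

-- The signed count of the completions from a point.

sign : Step → ℤ
sign s = -1ℤ ^ diagonals (s ∷ [])

sign-∷ : (s : Step) (w : Path) → -1ℤ ^ diagonals (s ∷ w) ≡ sign s * (-1ℤ ^ diagonals w)
sign-∷ N w = sym (ℤ.*-identityˡ _)
sign-∷ E w = sym (ℤ.*-identityˡ _)
sign-∷ D w = refl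

module _ (ν : LatticePath) where

  -- Points are in the doubled coordinates of `trace`.
  Above : Point → Set
  Above p = Any (OnOrAbove p) (trace origin (toPath ν))

  above? : Decidable Above
  above? p = any? (λ q → (proj₁ q ℕ.≟ proj₁ p) ×-dec (proj₂ q ℕ.≤? proj₂ p)) (trace origin (toPath ν))

  above-up : {x k l : ℕ} → k ≤ l → Above (x , k) → Above (x , l)
  above-up k≤l = Any.map (map₂ (λ h≤k → ℕ.≤-trans h≤k k≤l))

  -- The point of `ν` found in the odd column is the midpoint of an east step, whose end has the
  -- same height. Hence an east step with admissible midpoint has an admissible end.
  above-right : (x : ℕ) {k : ℕ} → Above (suc (x ℕ.* 2) , k) → Above (suc (suc (x ℕ.* 2)) , k)
  above-right x a with find a
  ... | _ , q∈ , refl , h≤k = lose (proj₂ (odd∈trace origin ν x q∈)) (refl , h≤k)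

  -- So an east and a diagonal step from the same point are blocked together.
  above-down : (x y : ℕ) → Above (suc (x ℕ.* 2) , suc (y ℕ.* 2)) → Above (suc (x ℕ.* 2) , y ℕ.* 2)
  above-down x y a with find a
  ... | _ , q∈ , refl , k≤1+2y with odd∈trace origin ν x q∈
  -- The height of `ν` here is even, so it differs from `suc (y ℕ.* 2)` and is at most `y ℕ.* 2`.
  ... | (h , refl) , _ = lose q∈ (refl , ℕ.≤-pred (ℕ.≤∧≢⇒< k≤1+2y (double≢odd h y)))

  -- Here `p` is in lattice coordinates. At `origin` this unfolds to `IsSchröderPath ν`.
  Completes : Point → Path → Set
  Completes p w = p ⊕ endpoint w ≡ endpoint (toPath ν) × All Above (trace (double p) w)

  completes? : (p : Point) → Decidable (Completes p)
  completes? p w = ≡-dec ℕ._≟_ ℕ._≟_ (p ⊕ endpoint w) (endpoint (toPath ν)) ×-dec all? above? (trace (double p) w)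

  weight : Point → Path → ℤ
  weight p w = (-1ℤ ^ diagonals w) when completes? p w

  -- The first step adds only its start and its midpoint to the trace, and both are above `ν` by
  -- hypothesis.
  completes-∷ : (p : Point) (s : Step) (w : Path) → Above (double p) → Above (double p ⊕ displacement s) →
                Completes p (s ∷ w) ⇔ Completes (p ⊕ displacement s) w
  completes-∷ p s w a m
    rewrite trace-double-∷ p s w | ⊕-assoc p (displacement s) (endpoint w) =
    mk⇔ (λ { (end , _ ∷ _ ∷ as) → end , as }) (λ (end , as) → end , a ∷ m ∷ as)

  ∑-weight-∷ : (p : Point) (s : Step) (ws : List Path) → Above (double p) → Above (double p ⊕ displacement s) →
               ∑ (weight p ∘ (s ∷_)) ws ≡ sign s * ∑ (weight (p ⊕ displacement s)) ws
  ∑-weight-∷ p s ws a m = trans (∑-cong weight-∷ ws) (∑-* (sign s) (weight (p ⊕ displacement s)) ws)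
    where
    open ≡-Reasoning
    weight-∷ : ∀ w → weight p (s ∷ w) ≡ sign s * weight (p ⊕ displacement s) w
    weight-∷ w = begin
      (-1ℤ ^ diagonals (s ∷ w)) when completes? p (s ∷ w)
        ≡⟨ when-⇔ (completes-∷ p s w a m) (completes? p (s ∷ w)) (completes? (p ⊕ displacement s) w) ⟩
      (-1ℤ ^ diagonals (s ∷ w)) when completes? (p ⊕ displacement s) w
        ≡⟨ cong (_when completes? (p ⊕ displacement s) w) (sign-∷ s w) ⟩
      (sign s * (-1ℤ ^ diagonals w)) when completes? (p ⊕ displacement s) w
        ≡⟨ *-when (sign s) _ (completes? (p ⊕ displacement s) w) ⟩
      sign s * weight (p ⊕ displacement s) w ∎

  ∑-weight-blocked : (p : Point) (s : Step) (ws : List Path) → ¬ Above (double p ⊕ displacement s) →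
                     ∑ (weight p ∘ (s ∷_)) ws ≡ 0ℤ
  ∑-weight-blocked p s ws ¬m =
    ∑-zero (λ w → when-false (completes? p (s ∷ w)) λ { (_ , _ ∷ m ∷ _) → ¬m m }) ws

  -- With `q` the displacement left to the endpoint, such a step overshoots it in some coordinate,
  -- and no path can come back.
  ∑-weight-beyond : (p : Point) {q : Point} (s : Step) (ws : List Path) → p ⊕ q ≡ endpoint (toPath ν) →
                    (∀ r → displacement s ⊕ r ≢ q) → ∑ (weight p ∘ (s ∷_)) ws ≡ 0ℤ
  ∑-weight-beyond p s ws end beyond =
    ∑-zero (λ w → when-false (completes? p (s ∷ w)) λ (end′ , _) →
      beyond (endpoint w) (⊕-cancelˡ p (trans end′ (sym end)))) ws

  weight-[]-end : (p : Point) → p ⊕ (0 , 0) ≡ endpoint (toPath ν) → Above (double p) → weight p [] ≡ 1ℤ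
  weight-[]-end p end a = when-true (completes? p []) (end , a ∷ [])

  -- Induction on `m`. Each step lowers `i + j`, the unit steps left, by at least one, so the bound
  -- `m` on the length loses no completion.
  ∑-weight : (m i j : ℕ) (p : Point) → p ⊕ (i , j) ≡ endpoint (toPath ν) → Above (double p) → i ℕ.+ j ≤ m →
             ∑ (weight p) (pathsUpToLength m) ≡ 1ℤ
  ∑-weight zero    zero    zero    p end a _ = cong (_+ℤ 0ℤ) (weight-[]-end p end a)
  ∑-weight (suc m) i       j       p end a i+j≤1+m = trans (∑-pathsUpToLength (weight p) m) (go i j end i+j≤1+m)
    where
    ws = pathsUpToLength m
    open ≡-Reasoning

    from : Step → ℤ
    from s = ∑ (weight p ∘ (s ∷_)) ws

    -- Once the four summands are literals, their total evaluates to `1ℤ` in each case of `go`.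
    total : ∀ {z n e d} → weight p [] ≡ z → from N ≡ n → from E ≡ e → from D ≡ d →
            weight p [] +ℤ (from N +ℤ (from E +ℤ from D)) ≡ z +ℤ (n +ℤ (e +ℤ d))
    total refl refl refl refl = refl

    beyond : ∀ {i j} → p ⊕ (i , j) ≡ endpoint (toPath ν) → ∀ s → (∀ r → displacement s ⊕ r ≢ (i , j)) →
             from s ≡ 0ℤ
    beyond end s = ∑-weight-beyond p s ws end

    []-beyond : ∀ {i j} → p ⊕ (i , j) ≡ endpoint (toPath ν) → (0 , 0) ≢ (i , j) → weight p [] ≡ 0ℤ
    []-beyond end 0≢ = when-false (completes? p []) λ (end′ , _) → 0≢ (⊕-cancelˡ p (trans end′ (sym end)))

    -- By induction the completions from the next point sum to 1, so an available step contributes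
    -- just its sign.
    take : ∀ s {i j} → p ⊕ (displacement s ⊕ (i , j)) ≡ endpoint (toPath ν) → i ℕ.+ j ≤ m →
           Above (double p ⊕ displacement s) → Above (double p ⊕ displacement s ⊕ displacement s) →
           from s ≡ sign s
    take s {i} {j} end i+j≤m mid next = begin
      from s
        ≡⟨ ∑-weight-∷ p s ws a mid ⟩
      sign s * ∑ (weight (p ⊕ displacement s)) ws
        ≡⟨ cong (sign s *_) (∑-weight m i j (p ⊕ displacement s) (trans (⊕-assoc p _ _) end)
             (subst Above (sym (double-⊕ p (displacement s))) next) i+j≤m) ⟩
      sign s * 1ℤ
        ≡⟨ ℤ.*-identityʳ (sign s) ⟩
      sign s ∎

    -- Rising keeps the same point of `ν` below, so only the height of the endpoint can stop a north
    -- step.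
    take-N : ∀ {i j} → p ⊕ (i , suc j) ≡ endpoint (toPath ν) → i ℕ.+ j ≤ m → from N ≡ 1ℤ
    take-N end i+j≤m = take N end i+j≤m mid (raise mid)
      where
      raise : ∀ {q} → Above q → Above (q ⊕ (0 , 1))
      raise {x , y} a rewrite ℕ.+-identityʳ x = above-up (ℕ.m≤m+n y 1) a
      mid = raise a

    -- The midpoint of the east step from `p`, which decides the availability of both E and D.
    odd : Point
    odd = suc (proj₁ p ℕ.* 2) , proj₂ p ℕ.* 2

    E-mid : double p ⊕ displacement E ≡ odd
    E-mid = cong₂ _,_ (ℕ.+-comm _ 1) (ℕ.+-identityʳ _)

    D-mid : double p ⊕ displacement D ≡ (suc (proj₁ p ℕ.* 2) , suc (proj₂ p ℕ.* 2))
    D-mid = cong₂ _,_ (ℕ.+-comm _ 1) (ℕ.+-comm _ 1)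

    take-E : ∀ {i j} → p ⊕ (suc i , j) ≡ endpoint (toPath ν) → i ℕ.+ j ≤ m → Above odd →
             from E ≡ 1ℤ
    take-E end i+j≤m o = take E end i+j≤m (subst Above (sym E-mid) o)
      (subst Above (sym (trans (cong (_⊕ (1 , 0)) E-mid) (cong₂ _,_ (ℕ.+-comm _ 1) (ℕ.+-identityʳ _))))
        (above-right (proj₁ p) o))

    -- The midpoint and the end of the diagonal step lie vertically above those of the east step.
    take-D : ∀ {i j} → p ⊕ (suc i , suc j) ≡ endpoint (toPath ν) → i ℕ.+ j ≤ m → Above odd →
             from D ≡ -1ℤ
    take-D end i+j≤m o = take D end i+j≤m (subst Above (sym D-mid) (above-up (ℕ.n≤1+n _) o))
      (subst Above (sym (trans (cong (_⊕ (1 , 1)) D-mid) (cong₂ _,_ (ℕ.+-comm _ 1) (ℕ.+-comm _ 1))))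
        (above-up (ℕ.m≤n+m _ 2) (above-right (proj₁ p) o)))

    go : ∀ i j → p ⊕ (i , j) ≡ endpoint (toPath ν) → i ℕ.+ j ≤ suc m →
         weight p [] +ℤ (from N +ℤ (from E +ℤ from D)) ≡ 1ℤ
    go zero zero end _ =
      total (weight-[]-end p end a) (beyond end N λ _ ()) (beyond end E λ _ ()) (beyond end D λ _ ())
    go zero (suc j) end (s≤s j≤m) =
      total ([]-beyond end λ ()) (take-N end j≤m) (beyond end E λ _ ()) (beyond end D λ _ ())
    go (suc i) zero end (s≤s i≤m) =
      total ([]-beyond end λ ()) (beyond end N λ _ ()) (take-E end i≤m o) (beyond end D λ _ ())
      where
      top : proj₂ (endpoint (toPath ν)) ≡ proj₂ p
      top = trans (sym (cong proj₂ end)) (ℕ.+-identityʳ _)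
      -- At the final height `ν` itself crosses this column no higher than `p`, so the east step
      -- cannot be blocked.
      o : Above odd
      o = subst (λ y → Above (suc (proj₁ p ℕ.* 2) , y ℕ.* 2)) top
            (top-above-odd origin ν refl z≤n (ℕ.<-≤-trans (ℕ.m<m+n _ (s≤s z≤n)) (ℕ.≤-reflexive (cong proj₁ end))))
    -- E and D are both available, with opposite signs, or both blocked; either way N alone accounts
    -- for the 1. The bound on `i + j` serves D, which lowers both coordinates.
    go (suc i) (suc j) end (s≤s i+1+j≤m) with above? odd | ℕ.≤-trans (ℕ.+-monoʳ-≤ i (ℕ.n≤1+n j)) i+1+j≤m
    ... | yes o | i+j≤m =
      total ([]-beyond end λ ()) (take-N end 1+i+j≤m) (take-E end i+1+j≤m o) (take-D end i+j≤m o)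
      where 1+i+j≤m = ℕ.≤-trans (ℕ.≤-reflexive (sym (ℕ.+-suc i j))) i+1+j≤m
    ... | no ¬o | _ =
      total ([]-beyond end λ ()) (take-N end 1+i+j≤m)
        (∑-weight-blocked p E ws (¬o ∘ subst Above E-mid))
        (∑-weight-blocked p D ws (¬o ∘ above-down (proj₁ p) (proj₂ p) ∘ subst Above D-mid))
      where 1+i+j≤m = ℕ.≤-trans (ℕ.≤-reflexive (sym (ℕ.+-suc i j))) i+1+j≤m

corollary2p8 : (ν : LatticePath) → (λ i → (-1ℤ ^ i) * (+ sch ν i)) SumsTo 1ℤ
-- The sum over paths here is that of `weight ν origin` by computation, since `origin` and its
-- double are both zero.
corollary2p8 ν = subst ((λ i → (-1ℤ ^ i) * (+ sch ν i)) SumsTo_) signed-count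
  (count-SumsTo (isSchröderPath? ν) diagonals (pathsUpToLength (length ν)))
  where
  signed-count : ∑ (weight ν origin) (pathsUpToLength (length ν)) ≡ 1ℤ
  -- The origin is the first point of `ν`, hence weakly above it.
  signed-count = ∑-weight ν (length ν) _ _ origin refl (lose (head∈trace origin (toPath ν)) (refl , z≤n))
    (ℕ.≤-reflexive (endpoint-length ν))
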